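{- Let $\mathbb{M}$ be a PNL-model, $\mathsf{a}$ an agent of $\mathbb{M}$, and $\phi$ a dPNL formula. Then: (1) Player I has a winning strategy for the dPNL semantic game starting at $\mathbf{P},\mathbb{M},\mathsf{a}:\phi$ if and only if $\mathbb{M},\mathsf{a}\Vdash\phi$. (2) Player You has a winning strategy for the dPNL semantic game starting at $\mathbf{P},\mathbb{M},\mathsf{a}:\phi$ if and only if $\mathbb{M},\mathsf{a}\not\Vdash\phi$.
   Context: Language. Fix countable sets $\mathrm{At}$ of propositional variables and $N$ of nominals. dPNL formulas: $\phi ::= p \mid R^+(i,j)\mid R^-(i,j)\mid \neg\phi\mid\phi\wedge\phi\mid\phi\vee\phi\mid\Diamond^+\phi\mid\Diamond^-\phi\mid[A]\phi\mid\langle\wedge\!\!\wedge+\rangle\phi\mid\langle\wedge\!\!\wedge-\rangle\phi\mid\langle\wedge\!\!\wedge\pm\rangle\phi\mid\langle\oplus\rangle\phi\mid\langle\ominus\rangle\phi$ with $p\in\mathrm{At}$, $i,j\in N$. Formulas $p$, $R^+(i,j)$, $R^-(i,j)$ are elementary. In $\Diamond^\pm,R^\pm,\mathsf{R}^\pm$ the symbol $\pm$ stands for either $+$ or $-$. Models. A model is $\mathbb{M}=\langle\mathsf{A},\mathsf{R}^+,\mathsf{R}^-,\mathsf{V},\mathsf{g}\rangle$ with $\mathsf{A}$ a non-empty set of agents, $\mathsf{g}:N\to\mathsf{A}$, $\mathsf{R}^\pm\subseteq\mathsf{A}\times\mathsf{A}$, $\mathsf{V}:\mathrm{At}\to\mathcal{P}(\mathsf{A})$.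 It is a PNL-model if $\mathsf{R}^+$ is reflexive, $\mathsf{R}^+,\mathsf{R}^-$ are symmetric and $\mathsf{R}^+\cap\mathsf{R}^-=\emptyset$. $\mathbb{M}\cup\{\mathsf{a}R^\pm_\leftrightarrow\mathsf{b}\}$ is $\mathbb{M}$ with $(\mathsf{a},\mathsf{b}),(\mathsf{b},\mathsf{a})$ added to $\mathsf{R}^\pm$; $\mathbb{M}\setminus\{\mathsf{a}R^\pm_\leftrightarrow\mathsf{b}\}$ is $\mathbb{M}$ with both pairs removed from $\mathsf{R}^\pm$. Kripke semantics. $\mathbb{M},\mathsf{a}\Vdash p$ iff $\mathsf{a}\in\mathsf{V}(p)$; $\mathbb{M},\mathsf{a}\Vdash R^\pm(i,j)$ iff $(\mathsf{g}(i),\mathsf{g}(j))\in\mathsf{R}^\pm$; $\neg,\wedge,\vee$ as usual; $\mathbb{M},\mathsf{a}\Vdash\Diamond^\pm\phi$ iff $\mathbb{M},\mathsf{b}\Vdash\phi$ for some $\mathsf{b}$ with $(\mathsf{a},\mathsf{b})\in\mathsf{R}^\pm$; $\mathbb{M},\mathsf{a}\Vdash[A]\phi$ iff $\mathbb{M},\mathsf{b}\Vdash\phi$ for all $\mathsf{b}\in\mathsf{A}$; and - $\mathbb{M},\mathsf{a}\Vdash\langle\wedge\!\!\wedge+\rangle\phi$ iff there are $\mathsf{b},\mathsf{c}\in\mathsf{A}$ with $(\mathsf{b},\mathsf{c})\notin\mathsf{R}^-$ and $\mathbb{M}\cup\{\mathsf{b}R^+_\leftrightarrow\mathsf{c}\},\mathsf{a}\Vdash\phi$;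 - $\mathbb{M},\mathsf{a}\Vdash\langle\wedge\!\!\wedge-\rangle\phi$ iff there are $\mathsf{b},\mathsf{c}\in\mathsf{A}$ with $(\mathsf{b},\mathsf{c})\notin\mathsf{R}^+$ and $\mathbb{M}\cup\{\mathsf{b}R^-_\leftrightarrow\mathsf{c}\},\mathsf{a}\Vdash\phi$; - $\mathbb{M},\mathsf{a}\Vdash\langle\wedge\!\!\wedge\pm\rangle\phi$ iff at least one of the two preceding right-hand conditions holds; - $\mathbb{M},\mathsf{a}\Vdash\langle\oplus\rangle\phi$ iff there is $\mathsf{b}$ with $(\mathsf{a},\mathsf{b})\in\mathsf{R}^-$ and $\mathbb{M}\cup\{\mathsf{a}R^+_\leftrightarrow\mathsf{b}\}\setminus\{\mathsf{a}R^-_\leftrightarrow\mathsf{b}\},\mathsf{a}\Vdash\phi$; - $\mathbb{M},\mathsf{a}\Vdash\langle\ominus\rangle\phi$ iff there is $\mathsf{b}\neq\mathsf{a}$ with $(\mathsf{a},\mathsf{b})\in\mathsf{R}^+$ and $\mathbb{M}\cup\{\mathsf{a}R^-_\leftrightarrow\mathsf{b}\}\setminus\{\mathsf{a}R^+_\leftrightarrow\mathsf{b}\},\mathsf{a}\Vdash\phi$. dPNL semantic game, between players I and You. States are $\mathbf{P},\mathbb{M},\mathsf{a}:\phi$ (I am proponent) and $\mathbf{O},\mathbb{M},\mathsf{a}:\phi$ (I am opponent). Rules: - $\mathbf{P},\mathbb{M},\mathsf{a}:\phi_1\wedge\phi_2$: You choose $k\in\{1,2\}$, continue with $\mathbf{P},\mathbb{M},\mathsf{a}:\phi_k$;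 $\mathbf{P},\mathbb{M},\mathsf{a}:\phi_1\vee\phi_2$: I choose $k$, continue likewise. At the corresponding $\mathbf{O}$-states the roles of I and You are exchanged and the game continues with $\mathbf{O},\mathbb{M},\mathsf{a}:\phi_k$. - $\mathbf{P},\mathbb{M},\mathsf{a}:\neg\phi$ continues with $\mathbf{O},\mathbb{M},\mathsf{a}:\phi$; $\mathbf{O},\mathbb{M},\mathsf{a}:\neg\phi$ continues with $\mathbf{P},\mathbb{M},\mathsf{a}:\phi$. - $\mathbf{P},\mathbb{M},\mathsf{a}:\Diamond^\pm\phi$: You win if $\mathsf{a}$ has no $\mathsf{R}^\pm$-successor; otherwise I choose an $\mathsf{R}^\pm$-successor $\mathsf{b}$, continue with $\mathbf{P},\mathbb{M},\mathsf{b}:\phi$. At $\mathbf{O}$-states: roles exchanged, continuing with $\mathbf{O}$. - $\mathbf{P},\mathbb{M},\mathsf{a}:[A]\phi$: You choose an agent $\mathsf{b}$, continue with $\mathbf{P},\mathbb{M},\mathsf{b}:\phi$. $\mathbf{O},\mathbb{M},\mathsf{a}:[A]\phi$: I choose $\mathsf{b}$, continue with $\mathbf{O},\mathbb{M},\mathsf{b}:\phi$. - $\mathbf{P},\mathbb{M},\mathsf{a}:\langle\wedge\!\!\wedge-\rangle\phi$: I choose $\mathsf{b},\mathsf{c}$ with $(\mathsf{b},\mathsf{c})\notin\mathsf{R}^+$, continue with $\mathbf{P},\mathbb{M}\cup\{\mathsf{b}R^-_\leftrightarrow\mathsf{c}\},\mathsf{a}:\phi$; You win if no such $\mathsf{b},\mathsf{c}$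 exist. - $\mathbf{P},\mathbb{M},\mathsf{a}:\langle\wedge\!\!\wedge+\rangle\phi$: I choose $\mathsf{b},\mathsf{c}$ with $(\mathsf{b},\mathsf{c})\notin\mathsf{R}^-$, continue with $\mathbf{P},\mathbb{M}\cup\{\mathsf{b}R^+_\leftrightarrow\mathsf{c}\},\mathsf{a}:\phi$. - $\mathbf{P},\mathbb{M},\mathsf{a}:\langle\wedge\!\!\wedge\pm\rangle\phi$: I choose to proceed as in one of the two preceding rules. - $\mathbf{P},\mathbb{M},\mathsf{a}:\langle\oplus\rangle\phi$: I choose $\mathsf{b}$ with $(\mathsf{a},\mathsf{b})\in\mathsf{R}^-$, continue with $\mathbf{P},\mathbb{M}\cup\{\mathsf{a}R^+_\leftrightarrow\mathsf{b}\}\setminus\{\mathsf{a}R^-_\leftrightarrow\mathsf{b}\},\mathsf{a}:\phi$; You win if there is no such $\mathsf{b}$. - $\mathbf{P},\mathbb{M},\mathsf{a}:\langle\ominus\rangle\phi$: I choose $\mathsf{b}\neq\mathsf{a}$ with $(\mathsf{a},\mathsf{b})\in\mathsf{R}^+$, continue with $\mathbf{P},\mathbb{M}\cup\{\mathsf{a}R^-_\leftrightarrow\mathsf{b}\}\setminus\{\mathsf{a}R^+_\leftrightarrow\mathsf{b}\},\mathsf{a}:\phi$; You win if there is no such $\mathsf{b}$. - For the last five modalities, the $\mathbf{O}$-rules are the same with the roles of I and You exchanged and $\mathbf{O}$ in place of $\mathbf{P}$. - Elementary $\phi_e$: at $\mathbf{P},\mathbb{M},\mathsf{a}:\phi_e$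 I win iff $\mathbb{M},\mathsf{a}\Vdash\phi_e$; at $\mathbf{O},\mathbb{M},\mathsf{a}:\phi_e$ I win iff $\mathbb{M},\mathsf{a}\not\Vdash\phi_e$; otherwise You win. Winning strategies have the usual meaning for two-player zero-sum win-lose games. -}

module Defs where

open import Data.Empty.Polymorphic using (⊥)
open import Data.Fin using (Fin; zero; suc)
open import Data.Product using (Σ-syntax; ∃; ∃₂; _×_; _,_)
open import Data.Sign using (Sign; +; -; opposite)
open import Data.Sum using (_⊎_; inj₁; inj₂)
open import Data.Unit.Polymorphic using (⊤; tt)
open import Induction.WellFounded using (WellFounded; Acc; acc)
open import Level using (Level; Lift; lift; _⊔_) renaming (suc to lsuc)
open import Relation.Binary.Core using (Rel)
open import Relation.Binary.Definitions using (Reflexive; Symmetric)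
open import Relation.Binary.PropositionalEquality using (_≡_; _≢_; refl)
open import Relation.Nullary using (¬_)
open import Relation.Unary using (Pred)

------------------------------------------------------------------------
-- Two-player zero-sum win-lose games

data Player : Set where
  I You : Player

record Game (s m : Level) : Set (lsuc (s ⊔ m)) where
  field
    State : Set s
    -- Irrelevant at states without moves.
    mover : State → Player
    Move  : State → Set m
    next  : (x : State) → Move x → State
    -- The outcome; only consulted at states without moves, where You win
    -- exactly if I do not.
    IWin  : State → Set m
    -- There are no infinite plays, so an outcome at the states without
    -- moves determines the winner of every play.
    wellFounded : WellFounded (λ y x → Σ[ μ ∈ Move x ] next x μ ≡ y)

  Terminal : State → Set m
  Terminal x = ¬ Move x

  Win : Player → State → Set m
  Win I   x = IWin x
  Win You x = ¬ IWin x

  data History (x₀ : State) : State → Set (s ⊔ m) where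
    start : History x₀ x₀
    _▷_   : ∀ {x} → History x₀ x → (μ : Move x) → History x₀ (next x μ)

  Strategy : Player → State → Set (s ⊔ m)
  Strategy X x₀ =
    ∀ {x} → History x₀ x → .(mover x ≡ X) → .(¬ Terminal x) → Move x

  data Consistent {X : Player} {x₀ : State} (σ : Strategy X x₀) :
                  ∀ {x} → History x₀ x → Set (s ⊔ m) where
    start  : Consistent σ start
    own    : ∀ {x} {h : History x₀ x} → Consistent σ h →
             (t : mover x ≡ X) (nt : ¬ Terminal x) →
             Consistent σ (h ▷ σ h t nt)
    others : ∀ {x} {h : History x₀ x} → Consistent σ h →
             mover x ≢ X → (μ : Move x) → Consistent σ (h ▷ μ)

  Winning : ∀ {X x₀} → Strategy X x₀ → Set (s ⊔ m)
  Winning {X} {x₀} σ =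
    ∀ {x} (h : History x₀ x) → Consistent σ h → Terminal x → Win X x

  HasWinningStrategy : Player → State → Set (s ⊔ m)
  HasWinningStrategy X x₀ = Σ[ σ ∈ Strategy X x₀ ] Winning σ

------------------------------------------------------------------------
-- Formulas

infixr 8 ¬′_ ◇[_]_ [A]_ ⟨⋀_⟩_ ⟨⋀±⟩_ ⟨⊕⟩_ ⟨⊖⟩_
infixr 7 _∧′_
infixr 6 _∨′_

data Formula (At Nom : Set) : Set where
  var              : At → Formula At Nom
  R[_]             : Sign → Nom → Nom → Formula At Nom
  ¬′_              : Formula At Nom → Formula At Nom
  _∧′_ _∨′_        : Formula At Nom → Formula At Nom → Formula At Nom
  ◇[_]_            : Sign → Formula At Nom → Formula At Nom
  [A]_             : Formula At Nom → Formula At Nom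
  ⟨⋀_⟩_            : Sign → Formula At Nom → Formula At Nom
  ⟨⋀±⟩_ ⟨⊕⟩_ ⟨⊖⟩_  : Formula At Nom → Formula At Nom

------------------------------------------------------------------------
-- Models

record Model (ℓ : Level) (At Nom : Set) : Set (lsuc ℓ) where
  field
    Agent    : Set ℓ
    nonEmpty : Agent
    rel      : Sign → Rel Agent ℓ
    V        : At → Pred Agent ℓ
    g        : Nom → Agent

open Model public

record IsPNL {ℓ At Nom} (M : Model ℓ At Nom) : Set ℓ where
  field
    reflexive⁺ : Reflexive (rel M +)
    symmetric  : ∀ s → Symmetric (rel M s)
    disjoint   : ∀ {a b} → ¬ (rel M + a b × rel M - a b)

-- The pair (x , y) is (b , c) or (c , b).
Link : ∀ {ℓ} {A : Set ℓ} → A → A → Rel A ℓ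
Link b c x y = (x ≡ b × y ≡ c) ⊎ (x ≡ c × y ≡ b)

infixl 5 _∪⟨_,_,_⟩ _∖⟨_,_,_⟩

_∪⟨_,_,_⟩ : ∀ {ℓ At Nom} (M : Model ℓ At Nom) →
            Agent M → Sign → Agent M → Model ℓ At Nom
M ∪⟨ b , s , c ⟩ = record M
  { rel = λ t x y → rel M t x y ⊎ (t ≡ s × Link b c x y) }

_∖⟨_,_,_⟩ : ∀ {ℓ At Nom} (M : Model ℓ At Nom) →
            Agent M → Sign → Agent M → Model ℓ At Nom
M ∖⟨ b , s , c ⟩ = record M
  { rel = λ t x y → rel M t x y × ¬ (t ≡ s × Link b c x y) }

------------------------------------------------------------------------
-- Kripke semantics

infix 4 _,_⊩_

_,_⊩_ : ∀ {ℓ At Nom} (M : Model ℓ At Nom) → Agent M →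
        Formula At Nom → Set ℓ
M , a ⊩ var p      = V M p a
M , a ⊩ R[ s ] i j = rel M s (g M i) (g M j)
M , a ⊩ ¬′ φ       = ¬ (M , a ⊩ φ)
M , a ⊩ φ ∧′ ψ     = (M , a ⊩ φ) × (M , a ⊩ ψ)
M , a ⊩ φ ∨′ ψ     = (M , a ⊩ φ) ⊎ (M , a ⊩ ψ)
M , a ⊩ ◇[ s ] φ   = ∃ λ b → rel M s a b × (M , b ⊩ φ)
M , a ⊩ [A] φ      = ∀ b → M , b ⊩ φ
M , a ⊩ ⟨⋀ s ⟩ φ   = ∃₂ λ b c →
  ¬ rel M (opposite s) b c × (M ∪⟨ b , s , c ⟩ , a ⊩ φ)
M , a ⊩ ⟨⋀±⟩ φ     =
  (∃₂ λ b c → ¬ rel M - b c × (M ∪⟨ b , + , c ⟩ , a ⊩ φ)) ⊎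
  (∃₂ λ b c → ¬ rel M + b c × (M ∪⟨ b , - , c ⟩ , a ⊩ φ))
M , a ⊩ ⟨⊕⟩ φ      = ∃ λ b →
  rel M - a b × (M ∪⟨ a , + , b ⟩ ∖⟨ a , - , b ⟩ , a ⊩ φ)
M , a ⊩ ⟨⊖⟩ φ      = ∃ λ b →
  b ≢ a × rel M + a b × (M ∪⟨ a , - , b ⟩ ∖⟨ a , + , b ⟩ , a ⊩ φ)

------------------------------------------------------------------------
-- The semantic game

-- My role: proponent or opponent.
data Role : Set where
  P O : Role

swap : Role → Role
swap P = O
swap O = P

proponent opponent : Role → Player
proponent P = I
proponent O = You
opponent  P = You
opponent  O = I

module _ {ℓ : Level} {At Nom : Set} where

  record GameState : Set (lsuc ℓ) where
    constructor ⟪_,_,_∶_⟫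
    field
      role    : Role
      model   : Model ℓ At Nom
      agent   : Agent model
      formula : Formula At Nom

  dMover : GameState → Player
  dMover ⟪ r , M , a ∶ φ ∧′ ψ ⟫ = opponent r
  dMover ⟪ r , M , a ∶ [A] φ ⟫  = opponent r
  -- At negations the only move is forced, at elementary formulas there is
  -- none; the value there is immaterial.
  dMover ⟪ r , M , a ∶ _ ⟫      = proponent r

  dMove : GameState → Set ℓ
  dMove ⟪ r , M , a ∶ var p ⟫      = ⊥
  dMove ⟪ r , M , a ∶ R[ s ] i j ⟫ = ⊥
  dMove ⟪ r , M , a ∶ ¬′ φ ⟫       = ⊤
  dMove ⟪ r , M , a ∶ φ ∧′ ψ ⟫     = Lift ℓ (Fin 2)
  dMove ⟪ r , M , a ∶ φ ∨′ ψ ⟫     = Lift ℓ (Fin 2)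
  dMove ⟪ r , M , a ∶ ◇[ s ] φ ⟫   = ∃ λ b → rel M s a b
  dMove ⟪ r , M , a ∶ [A] φ ⟫      = Agent M
  dMove ⟪ r , M , a ∶ ⟨⋀ s ⟩ φ ⟫   = ∃₂ λ b c → ¬ rel M (opposite s) b c
  dMove ⟪ r , M , a ∶ ⟨⋀±⟩ φ ⟫     =
    (∃₂ λ b c → ¬ rel M - b c) ⊎ (∃₂ λ b c → ¬ rel M + b c)
  dMove ⟪ r , M , a ∶ ⟨⊕⟩ φ ⟫      = ∃ λ b → rel M - a b
  dMove ⟪ r , M , a ∶ ⟨⊖⟩ φ ⟫      = ∃ λ b → b ≢ a × rel M + a b

  dNext : (x : GameState) → dMove x → GameState
  dNext ⟪ r , M , a ∶ ¬′ φ ⟫     _                 = ⟪ swap r , M , a ∶ φ ⟫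
  dNext ⟪ r , M , a ∶ φ ∧′ ψ ⟫   (lift zero)       = ⟪ r , M , a ∶ φ ⟫
  dNext ⟪ r , M , a ∶ φ ∧′ ψ ⟫   (lift (suc zero)) = ⟪ r , M , a ∶ ψ ⟫
  dNext ⟪ r , M , a ∶ φ ∨′ ψ ⟫   (lift zero)       = ⟪ r , M , a ∶ φ ⟫
  dNext ⟪ r , M , a ∶ φ ∨′ ψ ⟫   (lift (suc zero)) = ⟪ r , M , a ∶ ψ ⟫
  dNext ⟪ r , M , a ∶ ◇[ s ] φ ⟫ (b , _)           = ⟪ r , M , b ∶ φ ⟫
  dNext ⟪ r , M , a ∶ [A] φ ⟫    b                 = ⟪ r , M , b ∶ φ ⟫
  dNext ⟪ r , M , a ∶ ⟨⋀ s ⟩ φ ⟫ (b , c , _)       =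
    ⟪ r , M ∪⟨ b , s , c ⟩ , a ∶ φ ⟫
  dNext ⟪ r , M , a ∶ ⟨⋀±⟩ φ ⟫   (inj₁ (b , c , _)) =
    ⟪ r , M ∪⟨ b , + , c ⟩ , a ∶ φ ⟫
  dNext ⟪ r , M , a ∶ ⟨⋀±⟩ φ ⟫   (inj₂ (b , c , _)) =
    ⟪ r , M ∪⟨ b , - , c ⟩ , a ∶ φ ⟫
  dNext ⟪ r , M , a ∶ ⟨⊕⟩ φ ⟫    (b , _)           =
    ⟪ r , M ∪⟨ a , + , b ⟩ ∖⟨ a , - , b ⟩ , a ∶ φ ⟫
  dNext ⟪ r , M , a ∶ ⟨⊖⟩ φ ⟫    (b , _)           =
    ⟪ r , M ∪⟨ a , - , b ⟩ ∖⟨ a , + , b ⟩ , a ∶ φ ⟫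

  elementaryIWin : Role → (M : Model ℓ At Nom) → Agent M →
                   Formula At Nom → Set ℓ
  elementaryIWin P M a φ = M , a ⊩ φ
  elementaryIWin O M a φ = ¬ (M , a ⊩ φ)

  stuckIWin : Player → Set ℓ
  stuckIWin I   = ⊥
  stuckIWin You = ⊤

  -- At a non-elementary formula without moves, the player who would have
  -- to choose loses.
  dIWin : GameState → Set ℓ
  dIWin ⟪ r , M , a ∶ var p ⟫      = elementaryIWin r M a (var p)
  dIWin ⟪ r , M , a ∶ R[ s ] i j ⟫ = elementaryIWin r M a (R[ s ] i j)
  dIWin x                          = stuckIWin (dMover x)

  dWellFounded : WellFounded (λ y x → Σ[ μ ∈ dMove x ] dNext x μ ≡ y)
  dWellFounded ⟪ r , M , a ∶ φ ⟫ = go r M a φ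
    where
    go : ∀ r M a φ → Acc (λ y x → Σ[ μ ∈ dMove x ] dNext x μ ≡ y)
                         ⟪ r , M , a ∶ φ ⟫
    go r M a (var p)      = acc λ { (() , _) }
    go r M a (R[ s ] i j) = acc λ { (() , _) }
    go r M a (¬′ φ)       = acc λ { (_ , refl) → go _ _ _ φ }
    go r M a (φ ∧′ ψ)     = acc λ { (lift zero , refl) → go _ _ _ φ
                                  ; (lift (suc zero) , refl) → go _ _ _ ψ }
    go r M a (φ ∨′ ψ)     = acc λ { (lift zero , refl) → go _ _ _ φ
                                  ; (lift (suc zero) , refl) → go _ _ _ ψ }
    go r M a (◇[ s ] φ)   = acc λ { (_ , refl) → go _ _ _ φ }
    go r M a ([A] φ)      = acc λ { (_ , refl) → go _ _ _ φ }
    go r M a (⟨⋀ s ⟩ φ)   = acc λ { (_ , refl) → go _ _ _ φ }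
    go r M a (⟨⋀±⟩ φ)     = acc λ { (inj₁ _ , refl) → go _ _ _ φ
                                  ; (inj₂ _ , refl) → go _ _ _ φ }
    go r M a (⟨⊕⟩ φ)      = acc λ { (_ , refl) → go _ _ _ φ }
    go r M a (⟨⊖⟩ φ)      = acc λ { (_ , refl) → go _ _ _ φ }

dPNLGame : (ℓ : Level) (At Nom : Set) → Game (lsuc ℓ) ℓ
dPNLGame ℓ At Nom = record
  { State       = GameState {ℓ} {At} {Nom}
  ; mover       = dMover
  ; Move        = dMove
  ; next        = dNext
  ; IWin        = dIWin
  ; wellFounded = dWellFounded
  }

{-# OPTIONS --safe #-}
-- Truth of φ at P-states, and falsity at O-states, is locally consistent with
-- the rules: at a state of I it holds iff some move preserves it, at a state of
-- You iff all moves do.  In any game without infinite plays, such a predicate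
-- is exactly the winning region of I: whoever it favours wins by staying on
-- their side of it, and the two players cannot both have winning strategies,
-- since playing these against each other reaches an end won by both.
module Submission where

open import Defs
open import Axiom.ExcludedMiddle using (ExcludedMiddle)
open import Data.Empty using (⊥)
open import Data.Empty.Irrelevant using () renaming (⊥-elim to ⊥-elim-irr)
open import Data.Fin using (zero; suc)
open import Data.Nat using (ℕ)
open import Data.Product using (∃; _×_; _,_; proj₁; proj₂; uncurry)
open import Data.Sum using (inj₁; inj₂; [_,_]′)
open import Data.Unit.Polymorphic using (tt)
open import Function.Base using (_∘_)
open import Function.Bundles using (_↣_; _⇔_; mk⇔; module Equivalence)
open import Function.Construct.Identity using (⇔-id)
open import Induction.WellFounded using (Acc; acc)
open import Level using (Level; lift; _⊔_)
open import Relation.Binary.PropositionalEquality using (_≡_; _≢_; refl; sym; trans)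
open import Relation.Nullary using (¬_; yes; no; contradiction)
open import Relation.Nullary.Decidable using (decidable-stable)

open Equivalence using (to; from)

¬∀⇒∃¬ : ∀ {ℓ} → ExcludedMiddle ℓ → {A : Set ℓ} {B : A → Set ℓ} →
        ¬ (∀ a → B a) → ∃ λ a → ¬ B a
¬∀⇒∃¬ em ¬∀ = decidable-stable em λ ¬∃ →
  ¬∀ λ a → decidable-stable em λ ¬b → ¬∃ (a , ¬b)

I≢You : I ≢ You
I≢You ()

module _ {s m : Level} (G : Game s m) where
  open Game G

  record Invariant (X : Player) (W : State → Set m) : Set (s ⊔ m) where
    field
      ownMove   : ∀ {x} → mover x ≡ X → ¬ Terminal x → W x →
                  ∃ λ μ → W (next x μ)
      otherMove : ∀ {x} → mover x ≢ X → W x → ∀ μ → W (next x μ)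
      terminal  : ∀ {x} → Terminal x → W x → Win X x

  -- `atI` and `atYou` do not presuppose a move, so they also cover a stuck player: with no moves
  -- the existential is false and `¬ IWin x` makes I lose, while the universal is vacuous and
  -- `IWin x` makes You lose. `atEnd` is for ends whose outcome does not depend on the mover.
  data Balanced (W : State → Set m) (x : State) : Set (s ⊔ m) where
    atI   : mover x ≡ I → ¬ IWin x →
            W x ⇔ (∃ λ μ → W (next x μ)) → Balanced W x
    atYou : mover x ≡ You → IWin x →
            W x ⇔ (∀ μ → W (next x μ)) → Balanced W x
    atEnd : Terminal x → W x ⇔ IWin x → Balanced W x

  module _ (em : ExcludedMiddle m) where

    module _ (W : State → Set m) where

      -- A strategy must answer at every history, without a proof of `W x` and with only an
      -- irrelevant proof that a move exists. Excluded middle therefore finds the move: one that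
      -- keeps `W` if there is any, otherwise an arbitrary one.
      preservingMove : ∀ x → .(¬ Terminal x) → Move x
      preservingMove x nt with em {P = ∃ λ μ → W (next x μ)} | em {P = Move x}
      ... | yes (μ , _) | _     = μ
      ... | no _        | yes μ = μ
      ... | no _        | no t  = ⊥-elim-irr (nt t)

      preservingMove-preserves : ∀ x .(nt : ¬ Terminal x) →
        (∃ λ μ → W (next x μ)) → W (next x (preservingMove x nt))
      preservingMove-preserves x nt w
        with em {P = ∃ λ μ → W (next x μ)} | em {P = Move x}
      ... | yes (_ , w′) | _ = w′
      ... | no ¬w        | _ = contradiction w ¬w

    -- The strategy is positional; induction on consistency keeps every state of the play in `W`.
    invariant⇒winning : ∀ {X W x₀} → Invariant X W → W x₀ →
                        HasWinningStrategy X x₀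
    invariant⇒winning {X} {W} {x₀} inv w₀ =
      σ , λ _ c t → terminal t (preserved c)
      where
      open Invariant inv

      σ : Strategy X x₀
      σ {x} _ _ nt = preservingMove W x nt

      preserved : ∀ {x} {h : History x₀ x} → Consistent σ h → W x
      preserved start              = w₀
      preserved (own c t nt)       =
        preservingMove-preserves W _ nt (ownMove t nt (preserved c))
      preserved (others c m≢X μ)   = otherMove m≢X (preserved c) μ

    -- `clash` extends a single history that stays consistent with both strategies, by recursion on
    -- accessibility.
    notBothWinning : ∀ {x₀} → HasWinningStrategy I x₀ →
                     ¬ HasWinningStrategy You x₀
    notBothWinning {x₀} (σ , wσ) (τ , wτ) = clash start start start (wellFounded x₀)
      where
      clash : ∀ {x} (h : History x₀ x) → Consistent σ h → Consistent τ h →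
              Acc (λ z y → ∃ λ μ → next y μ ≡ z) x → ⊥
      clash {x} h c d (acc rs) with em {P = Move x}
      ... | no t = wτ h d t (wσ h c t)
      -- `μ` only witnesses that the play goes on; the move actually made is the one prescribed by
      -- the mover's strategy.
      ... | yes μ with mover x in eq
      ...   | I   = clash _ (own c eq (λ t → t μ))
                      (others d (λ e → I≢You (trans (sym eq) e)) _) (rs (_ , refl))
      ...   | You = clash _ (others c (λ e → I≢You (trans (sym e) eq)) _)
                      (own d eq (λ t → t μ)) (rs (_ , refl))

    module _ {W : State → Set m} (bal : ∀ x → Balanced W x) where

      balanced⇒invariant-I : Invariant I W
      balanced⇒invariant-I = record
        { ownMove = ownMove ; otherMove = otherMove ; terminal = terminal }
        where
        ownMove : ∀ {x} → mover x ≡ I → ¬ Terminal x → W x → ∃ λ μ → W (next x μ)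
        ownMove {x} p nt w with bal x
        ... | atI _ _ e   = to e w
        ... | atYou q _ _ = contradiction (trans (sym p) q) I≢You
        ... | atEnd t _   = contradiction t nt

        otherMove : ∀ {x} → mover x ≢ I → W x → ∀ μ → W (next x μ)
        otherMove {x} p w μ with bal x
        ... | atI q _ _   = contradiction q p
        ... | atYou _ _ e = to e w μ
        ... | atEnd t _   = contradiction μ t

        terminal : ∀ {x} → Terminal x → W x → IWin x
        terminal {x} t w with bal x
        ... | atI _ _ e   = contradiction (proj₁ (to e w)) t
        ... | atYou _ i _ = i
        ... | atEnd _ e   = to e w

      balanced⇒invariant-You : Invariant You (¬_ ∘ W)
      balanced⇒invariant-You = record
        { ownMove = ownMove ; otherMove = otherMove ; terminal = terminal }
        where
        ownMove : ∀ {x} → mover x ≡ You → ¬ Terminal x → ¬ W x →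
              ∃ λ μ → ¬ W (next x μ)
        ownMove {x} p nt ¬w with bal x
        ... | atI q _ _   = contradiction (trans (sym q) p) I≢You
        -- Leaving `W` requires a concrete move, which is extracted classically from the failure of
        -- the universal.
        ... | atYou _ _ e = ¬∀⇒∃¬ em (¬w ∘ from e)
        ... | atEnd t _   = contradiction t nt

        otherMove : ∀ {x} → mover x ≢ You → ¬ W x → ∀ μ → ¬ W (next x μ)
        otherMove {x} p ¬w μ w with bal x
        ... | atI _ _ e   = ¬w (from e (μ , w))
        ... | atYou q _ _ = p q
        ... | atEnd t _   = t μ

        terminal : ∀ {x} → Terminal x → ¬ W x → ¬ IWin x
        terminal {x} t ¬w i with bal x
        ... | atI _ ¬i _  = ¬i i
        ... | atYou _ _ e = ¬w (from e λ μ → contradiction μ t)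
        ... | atEnd _ e   = ¬w (from e i)

      -- Both invariants give the directions from right to left. Since `W x` and its negation are
      -- exhaustive, each converse follows: a winner on the wrong side would face an opponent who
      -- also wins.
      balanced⇒winningRegion : ∀ x →
        (HasWinningStrategy I x ⇔ W x) × (HasWinningStrategy You x ⇔ (¬ W x))
      balanced⇒winningRegion x =
        mk⇔ (λ ws → decidable-stable em (notBothWinning ws ∘ winsYou)) winsI ,
        mk⇔ (λ ws w → notBothWinning (winsI w) ws) winsYou
        where
        winsI : W x → HasWinningStrategy I x
        winsI = invariant⇒winning balanced⇒invariant-I
        winsYou : ¬ W x → HasWinningStrategy You x
        winsYou = invariant⇒winning balanced⇒invariant-You

module _ {ℓ : Level} {At Nom : Set} where

  Favourable : GameState {ℓ} {At} {Nom} → Set ℓ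
  Favourable ⟪ P , M , a ∶ φ ⟫ = M , a ⊩ φ
  Favourable ⟪ O , M , a ∶ φ ⟫ = ¬ (M , a ⊩ φ)

  -- Derives the O-rule of an existential modality, where the choice is Yours, from its P-rule.
  ¬-∃ : {A C : Set ℓ} {B : A → Set ℓ} → C ⇔ ∃ B → (¬ C) ⇔ (∀ a → ¬ B a)
  ¬-∃ e = mk⇔ (λ ¬c a b → ¬c (from e (a , b))) (λ ¬b c → uncurry ¬b (to e c))

  module _ (M : Model ℓ At Nom) (a : Agent M) where

    FavourableAfter : ∀ r φ → dMove ⟪ r , M , a ∶ φ ⟫ → Set ℓ
    FavourableAfter r φ μ = Favourable (dNext ⟪ r , M , a ∶ φ ⟫ μ)

    ∧-⇔ : ∀ φ ψ → (M , a ⊩ φ ∧′ ψ) ⇔ (∀ μ → FavourableAfter P (φ ∧′ ψ) μ)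
    ∧-⇔ φ ψ = mk⇔ (λ { (p , q) (lift zero) → p ; (p , q) (lift (suc zero)) → q })
                  (λ f → f (lift zero) , f (lift (suc zero)))

    ∨-⇔ : ∀ φ ψ → (M , a ⊩ φ ∨′ ψ) ⇔ ∃ (FavourableAfter P (φ ∨′ ψ))
    ∨-⇔ φ ψ = mk⇔ [ lift zero ,_ , lift (suc zero) ,_ ]′
                  (λ { (lift zero , p) → inj₁ p ; (lift (suc zero) , q) → inj₂ q
                     ; (lift (suc (suc ())) , _) })

    ¬∧-⇔ : ExcludedMiddle ℓ → ∀ φ ψ → (¬ (M , a ⊩ φ ∧′ ψ)) ⇔
           ∃ (FavourableAfter O (φ ∧′ ψ))
    ¬∧-⇔ em φ ψ = mk⇔ split
                   (λ { (lift zero , ¬p) → ¬p ∘ proj₁ ; (lift (suc zero) , ¬q) → ¬q ∘ proj₂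
                      ; (lift (suc (suc ())) , _) })
      where
      split : ¬ (M , a ⊩ φ ∧′ ψ) → ∃ (FavourableAfter O (φ ∧′ ψ))
      split ¬pq with em {P = M , a ⊩ φ}
      ... | yes p = lift (suc zero) , λ q → ¬pq (p , q)
      ... | no ¬p = lift zero , ¬p

    -- Not an instance of `¬-∃`: `dNext` is stuck until the move is split into cases, so
    -- `FavourableAfter O` does not unfold to the negation of `FavourableAfter P`. The same holds
    -- for `⟨⋀±⟩`, whereas pairs unfold by eta.
    ¬∨-⇔ : ∀ φ ψ → (¬ (M , a ⊩ φ ∨′ ψ)) ⇔
           (∀ μ → FavourableAfter O (φ ∨′ ψ) μ)
    ¬∨-⇔ φ ψ = mk⇔ (λ { ¬p∨q (lift zero) → ¬p∨q ∘ inj₁ ; ¬p∨q (lift (suc zero)) → ¬p∨q ∘ inj₂ })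
                   (λ f → [ f (lift zero) , f (lift (suc zero)) ]′)

    ◇-⇔ : ∀ s φ → (M , a ⊩ ◇[ s ] φ) ⇔ ∃ (FavourableAfter P (◇[ s ] φ))
    ◇-⇔ s φ = mk⇔ (λ (b , r , p) → (b , r) , p) (λ ((b , r) , p) → b , r , p)

    ⋀-⇔ : ∀ s φ → (M , a ⊩ ⟨⋀ s ⟩ φ) ⇔ ∃ (FavourableAfter P (⟨⋀ s ⟩ φ))
    ⋀-⇔ s φ = mk⇔ (λ (b , c , r , p) → (b , c , r) , p)
                  (λ ((b , c , r) , p) → b , c , r , p)

    ⋀±-⇔ : ∀ φ → (M , a ⊩ ⟨⋀±⟩ φ) ⇔ ∃ (FavourableAfter P (⟨⋀±⟩ φ))
    ⋀±-⇔ φ = mk⇔ (λ { (inj₁ (b , c , r , p)) → inj₁ (b , c , r) , p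
                    ; (inj₂ (b , c , r , p)) → inj₂ (b , c , r) , p })
                 (λ { (inj₁ (b , c , r) , p) → inj₁ (b , c , r , p)
                    ; (inj₂ (b , c , r) , p) → inj₂ (b , c , r , p) })

    ¬⋀±-⇔ : ∀ φ → (¬ (M , a ⊩ ⟨⋀±⟩ φ)) ⇔
            (∀ μ → FavourableAfter O (⟨⋀±⟩ φ) μ)
    ¬⋀±-⇔ φ = mk⇔ (λ { ¬p (inj₁ (b , c , r)) p → ¬p (inj₁ (b , c , r , p))
                     ; ¬p (inj₂ (b , c , r)) p → ¬p (inj₂ (b , c , r , p)) })
                  (λ { f (inj₁ (b , c , r , p)) → f (inj₁ (b , c , r)) p
                     ; f (inj₂ (b , c , r , p)) → f (inj₂ (b , c , r)) p })

    ⊕-⇔ : ∀ φ → (M , a ⊩ ⟨⊕⟩ φ) ⇔ ∃ (FavourableAfter P (⟨⊕⟩ φ))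
    ⊕-⇔ φ = mk⇔ (λ (b , r , p) → (b , r) , p) (λ ((b , r) , p) → b , r , p)

    ⊖-⇔ : ∀ φ → (M , a ⊩ ⟨⊖⟩ φ) ⇔ ∃ (FavourableAfter P (⟨⊖⟩ φ))
    ⊖-⇔ φ = mk⇔ (λ (b , b≢a , r , p) → (b , b≢a , r) , p)
                (λ ((b , b≢a , r) , p) → b , b≢a , r , p)

  -- Excluded middle enters only at O-states, for negation, conjunction and `[A]`, where falsity
  -- must yield a truth, a failing conjunct or a counterexample agent.
  favourable-balanced : ExcludedMiddle ℓ → ∀ x → Balanced (dPNLGame ℓ At Nom) Favourable x
  favourable-balanced _  ⟪ P , M , a ∶ var p ⟫      = atEnd (λ ()) (⇔-id _)
  favourable-balanced _  ⟪ O , M , a ∶ var p ⟫      = atEnd (λ ()) (⇔-id _)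
  favourable-balanced _  ⟪ P , M , a ∶ R[ s ] i j ⟫ = atEnd (λ ()) (⇔-id _)
  favourable-balanced _  ⟪ O , M , a ∶ R[ s ] i j ⟫ = atEnd (λ ()) (⇔-id _)
  -- The forced move is the only one, so "some move" and "all moves" agree and the nominal mover is
  -- harmless.
  favourable-balanced _  ⟪ P , M , a ∶ ¬′ φ ⟫       = atI refl (λ ()) (mk⇔ (tt ,_) proj₂)
  favourable-balanced em ⟪ O , M , a ∶ ¬′ φ ⟫       =
    atYou refl tt (mk⇔ (λ ¬¬p _ → decidable-stable em ¬¬p) (λ p ¬p → ¬p (p tt)))
  favourable-balanced _  ⟪ P , M , a ∶ φ ∧′ ψ ⟫     = atYou refl tt (∧-⇔ M a φ ψ)
  favourable-balanced em ⟪ O , M , a ∶ φ ∧′ ψ ⟫     = atI refl (λ ()) (¬∧-⇔ M a em φ ψ)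
  favourable-balanced _  ⟪ P , M , a ∶ [A] φ ⟫      = atYou refl tt (⇔-id _)
  favourable-balanced em ⟪ O , M , a ∶ [A] φ ⟫      = atI refl (λ ())
    (mk⇔ (¬∀⇒∃¬ em) (λ (b , ¬p) p → ¬p (p b)))
  favourable-balanced _  ⟪ P , M , a ∶ φ ∨′ ψ ⟫     = atI refl (λ ()) (∨-⇔ M a φ ψ)
  favourable-balanced _  ⟪ O , M , a ∶ φ ∨′ ψ ⟫     = atYou refl tt (¬∨-⇔ M a φ ψ)
  favourable-balanced _  ⟪ P , M , a ∶ ◇[ s ] φ ⟫   = atI refl (λ ()) (◇-⇔ M a s φ)
  favourable-balanced _  ⟪ O , M , a ∶ ◇[ s ] φ ⟫   = atYou refl tt (¬-∃ (◇-⇔ M a s φ))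
  favourable-balanced _  ⟪ P , M , a ∶ ⟨⋀ s ⟩ φ ⟫   = atI refl (λ ()) (⋀-⇔ M a s φ)
  favourable-balanced _  ⟪ O , M , a ∶ ⟨⋀ s ⟩ φ ⟫   = atYou refl tt (¬-∃ (⋀-⇔ M a s φ))
  favourable-balanced _  ⟪ P , M , a ∶ ⟨⋀±⟩ φ ⟫     = atI refl (λ ()) (⋀±-⇔ M a φ)
  favourable-balanced _  ⟪ O , M , a ∶ ⟨⋀±⟩ φ ⟫     = atYou refl tt (¬⋀±-⇔ M a φ)
  favourable-balanced _  ⟪ P , M , a ∶ ⟨⊕⟩ φ ⟫      = atI refl (λ ()) (⊕-⇔ M a φ)
  favourable-balanced _  ⟪ O , M , a ∶ ⟨⊕⟩ φ ⟫      = atYou refl tt (¬-∃ (⊕-⇔ M a φ))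
  favourable-balanced _  ⟪ P , M , a ∶ ⟨⊖⟩ φ ⟫      = atI refl (λ ()) (⊖-⇔ M a φ)
  favourable-balanced _  ⟪ O , M , a ∶ ⟨⊖⟩ φ ⟫      = atYou refl tt (¬-∃ (⊖-⇔ M a φ))

theorem5 : ∀ {ℓ} → ExcludedMiddle ℓ →
    {At Nom : Set} → At ↣ ℕ → Nom ↣ ℕ →
    (M : Model ℓ At Nom) → IsPNL M → (a : Agent M) (φ : Formula At Nom) →
    (Game.HasWinningStrategy (dPNLGame ℓ At Nom) I ⟪ P , M , a ∶ φ ⟫ ⇔ (M , a ⊩ φ)) ×
    (Game.HasWinningStrategy (dPNLGame ℓ At Nom) You ⟪ P , M , a ∶ φ ⟫ ⇔ (¬ (M , a ⊩ φ)))
theorem5 {ℓ} em {At} {Nom} _ _ M _ a φ =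
  balanced⇒winningRegion (dPNLGame ℓ At Nom) em (favourable-balanced em) ⟪ P , M , a ∶ φ ⟫
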